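{- $\mathrm{PrC}^{\oplus}=\mathcal D_T$; in particular also $\mathrm{BP}^{\oplus}=\mathrm{BPf}^{\oplus}=\mathcal D_T$.
   Context: Types $\sigma,\tau::=\mathbb N\mid\sigma\to\tau\mid\sigma\times\tau$; $T^{\oplus}$ terms $M,N::=x\mid\lambda x.M\mid MN\mid\langle M,N\rangle\mid\pi_1\mid\pi_2\mid\mathtt{rec}\mid\mathtt 0\mid\mathtt S\mid M\oplus N$, simply typed with $\mathtt 0:\mathbb N$, $\mathtt S:\mathbb N\to\mathbb N$, $\mathtt{rec}:(\sigma\times(\mathbb N\to\sigma\to\sigma)\times\mathbb N)\to\sigma$, $\pi_1:(\sigma\times\tau)\to\sigma$, $\pi_2:(\sigma\times\tau)\to\tau$, $M\oplus N:\sigma$ if $M,N:\sigma$; Gödel's System T is the fragment without $\oplus$. Numerals $\mathbf 0=\mathtt 0$, $\mathbf{n+1}=\mathtt S\mathbf n$. Values: closed terms of $V,W::=\lambda x.M\mid\pi_1\mid\pi_2\mid\langle V,W\rangle\mid\mathtt{rec}\mid\mathtt 0\mid\mathtt S\mid\mathtt SV$. Weak call-by-value reduction from closed terms to (sub)distributions: $(\lambda x.M)V\to\{M[V/x]\}$; if $M\to\mu$ then $MV\to\mu V$ (pushforward); if $N\to\nu$ then $MN\to M\nu$; pairs left then right; $\mathtt{rec}\langle U,V,\mathtt 0\rangle\to\{U\}$; $\mathtt{rec}\langle U,V,\mathtt S\mathbf n\rangle\to\{V\mathbf n(\mathtt{rec}\langle U,V,\mathbf n\rangle)\}$; $\pi_i$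 project pairs of values; $M\oplus N\to\frac12\{M\}+\frac12\{N\}$; lifted to distributions (reduce reducible support elements, keep values). Evaluation $[\![M]\!](V)=\lim_k\mu_k(V)$ with $\mu_0=\{M\}$, $\mu_{k+1}$ the reduct of $\mu_k$. $\mathcal D_T$: the set of $f:\mathbb N\to\mathbb N$ such that some closed System T term $M:\mathbb N\to\mathbb N$ reduces $M\,\mathbf n$ to $\mathbf{f(n)}$ for all $n$. $\mathrm{BP}^{\oplus}$ (resp. $\mathrm{PrC}^{\oplus}$): the $f$ for which there is a closed $M:\mathbb N\to\mathbb N$ in $T^{\oplus}$ with $[\![M\,\mathbf n]\!](\mathbf{f(n)})\ge\frac23$ (resp. $>\frac12$) for all $n$. $\mathrm{BPf}^{\oplus}$: the $f$ for which there are $h\in\mathcal D_T$ (with $h(n)\neq0$) and a closed $M:\mathbb N\to\mathbb N$ in $T^{\oplus}$ with $[\![M\,\mathbf n]\!](\mathbf{f(n)})>\frac12+\frac1{h(n)}$ for all $n$. -}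

module Defs where

open import Data.Nat as ℕ using (ℕ; zero; suc)
open import Data.Integer using (+_)
open import Data.Rational using (ℚ; _/_; 0ℚ; 1ℚ; ½; _+_; _-_; _*_; _<_; _≤_)
open import Data.List using (List; []; _∷_; map; concatMap; foldr)
open import Data.Maybe using (Maybe; just; nothing)
open import Data.Product using (_×_; _,_; Σ; ∃; ∃-syntax)
open import Function using (_∘_)
open import Relation.Nullary using (yes; no)
open import Relation.Binary.PropositionalEquality using (_≡_; _≢_)

infixr 7 _⇒_
infixr 8 _×ₜ_

data Ty : Set where
  nat  : Ty
  _⇒_  : Ty → Ty → Ty
  _×ₜ_ : Ty → Ty → Ty

Ctx : Set
Ctx = List Ty

data _∋_ : Ctx → Ty → Set where
  here  : ∀ {Γ σ} → (σ ∷ Γ) ∋ σ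
  there : ∀ {Γ σ τ} → Γ ∋ σ → (τ ∷ Γ) ∋ σ

-- ⟨U,V,n⟩ is read as the right-nested pair ⟨U,⟨V,n⟩⟩
data Tm (Γ : Ctx) : Ty → Set where
  var  : ∀ {σ} → Γ ∋ σ → Tm Γ σ
  lam  : ∀ {σ τ} → Tm (σ ∷ Γ) τ → Tm Γ (σ ⇒ τ)
  app  : ∀ {σ τ} → Tm Γ (σ ⇒ τ) → Tm Γ σ → Tm Γ τ
  pair : ∀ {σ τ} → Tm Γ σ → Tm Γ τ → Tm Γ (σ ×ₜ τ)
  π₁   : ∀ {σ τ} → Tm Γ ((σ ×ₜ τ) ⇒ σ)
  π₂   : ∀ {σ τ} → Tm Γ ((σ ×ₜ τ) ⇒ τ)
  rec  : ∀ {σ} → Tm Γ ((σ ×ₜ ((nat ⇒ σ ⇒ σ) ×ₜ nat)) ⇒ σ)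
  zer  : Tm Γ nat
  suc' : Tm Γ (nat ⇒ nat)
  _⊕_  : ∀ {σ} → Tm Γ σ → Tm Γ σ → Tm Γ σ

data PlusFree {Γ : Ctx} : ∀ {σ} → Tm Γ σ → Set where
  var  : ∀ {σ} (x : Γ ∋ σ) → PlusFree (var x)
  lam  : ∀ {σ τ} {M : Tm (σ ∷ Γ) τ} → PlusFree M → PlusFree (lam M)
  app  : ∀ {σ τ} {M : Tm Γ (σ ⇒ τ)} {N : Tm Γ σ} →
         PlusFree M → PlusFree N → PlusFree (app M N)
  pair : ∀ {σ τ} {M : Tm Γ σ} {N : Tm Γ τ} →
         PlusFree M → PlusFree N → PlusFree (pair M N)
  π₁   : ∀ {σ τ} → PlusFree (π₁ {σ = σ} {τ = τ})
  π₂   : ∀ {σ τ} → PlusFree (π₂ {σ = σ} {τ = τ})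
  rec  : ∀ {σ} → PlusFree (rec {σ = σ})
  zer  : PlusFree zer
  suc' : PlusFree suc'

Ren : Ctx → Ctx → Set
Ren Γ Δ = ∀ {σ} → Γ ∋ σ → Δ ∋ σ

ext : ∀ {Γ Δ τ} → Ren Γ Δ → Ren (τ ∷ Γ) (τ ∷ Δ)
ext ρ here      = here
ext ρ (there x) = there (ρ x)

rename : ∀ {Γ Δ σ} → Ren Γ Δ → Tm Γ σ → Tm Δ σ
rename ρ (var x)    = var (ρ x)
rename ρ (lam M)    = lam (rename (ext ρ) M)
rename ρ (app M N)  = app (rename ρ M) (rename ρ N)
rename ρ (pair M N) = pair (rename ρ M) (rename ρ N)
rename ρ π₁         = π₁
rename ρ π₂         = π₂
rename ρ rec        = rec
rename ρ zer        = zer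
rename ρ suc'       = suc'
rename ρ (M ⊕ N)    = rename ρ M ⊕ rename ρ N

Sub : Ctx → Ctx → Set
Sub Γ Δ = ∀ {σ} → Γ ∋ σ → Tm Δ σ

exts : ∀ {Γ Δ τ} → Sub Γ Δ → Sub (τ ∷ Γ) (τ ∷ Δ)
exts s here      = var here
exts s (there x) = rename there (s x)

subst : ∀ {Γ Δ σ} → Sub Γ Δ → Tm Γ σ → Tm Δ σ
subst s (var x)    = s x
subst s (lam M)    = lam (subst (exts s) M)
subst s (app M N)  = app (subst s M) (subst s N)
subst s (pair M N) = pair (subst s M) (subst s N)
subst s π₁         = π₁
subst s π₂         = π₂
subst s rec        = rec
subst s zer        = zer
subst s suc'       = suc'
subst s (M ⊕ N)    = subst s M ⊕ subst s N

_[_] : ∀ {Γ σ τ} → Tm (σ ∷ Γ) τ → Tm Γ σ → Tm Γ τ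
_[_] {Γ} {σ} M V = subst s M
  where
  s : Sub (σ ∷ Γ) Γ
  s here      = V
  s (there x) = var x

num : ℕ → Tm [] nat
num zero    = zer
num (suc n) = app suc' (num n)

-- Weak call-by-value reduction to finite (sub)distributions,
-- represented as lists of weighted closed terms.

Dist : Ty → Set
Dist σ = List (ℚ × Tm [] σ)

dirac : ∀ {σ} → Tm [] σ → Dist σ
dirac M = (1ℚ , M) ∷ []

mapD : ∀ {σ τ} → (Tm [] σ → Tm [] τ) → Dist σ → Dist τ
mapD g = map (λ { (p , M) → (p , g M) })

-- redex contraction for an application of a value to a value
-- (nothing = no redex; this only happens for values such as S V)
contract : ∀ {σ τ} → Tm [] (σ ⇒ τ) → Tm [] σ → Maybe (Dist τ)
contract (lam M) V                              = just (dirac (M [ V ]))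
contract π₁ (pair V W)                          = just (dirac V)
contract π₂ (pair V W)                          = just (dirac W)
contract rec (pair U (pair V zer))              = just (dirac U)
contract rec (pair U (pair V (app suc' n)))     =
  just (dirac (app (app V n) (app rec (pair U (pair V n)))))
contract _ _                                    = nothing

-- one step; nothing means the term is irreducible (a value)
step : ∀ {σ} → Tm [] σ → Maybe (Dist σ)
step (var ())
step (lam M) = nothing
step (app M N) with step N
... | just ν = just (mapD (app M) ν)
... | nothing with step M
...   | just μ  = just (mapD (λ M' → app M' N) μ)
...   | nothing = contract M N
step (pair M N) with step M
... | just μ = just (mapD (λ M' → pair M' N) μ)
... | nothing with step N
...   | just ν  = just (mapD (pair M) ν)
...   | nothing = nothing
step π₁ = nothing
step π₂ = nothing
step rec = nothing
step zer = nothing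
step suc' = nothing
step (M ⊕ N) = just ((½ , M) ∷ (½ , N) ∷ [])

stepD : ∀ {σ} → Dist σ → Dist σ
stepD = concatMap f
  where
  f : ∀ {σ} → ℚ × Tm [] σ → Dist σ
  f (p , M) with step M
  ... | nothing = (p , M) ∷ []
  ... | just ν  = map (λ { (q , N) → (p * q , N) }) ν

evalStep : ∀ {σ} → ℕ → Tm [] σ → Dist σ
evalStep zero    M = dirac M
evalStep (suc k) M = stepD (evalStep k M)

numeral? : Tm [] nat → Maybe ℕ
numeral? zer            = just zero
numeral? (app suc' M) with numeral? M
... | just n  = just (suc n)
... | nothing = nothing
numeral? _              = nothing

massAt : ℕ → Dist nat → ℚ
massAt n = foldr (λ { (p , M) acc → w p (numeral? M) + acc }) 0ℚ
  where
  w : ℚ → Maybe ℕ → ℚ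
  w p (just m) with m ℕ.≟ n
  ... | yes _ = p
  ... | no _ = 0ℚ
  w p nothing = 0ℚ

prob : ℕ → Tm [] nat → ℕ → ℚ
prob n M k = massAt n (evalStep k M)

-- Comparing the limit of a (convergent) rational sequence with a rational.
-- For a convergent sequence a with limit L:
--   L ≥ c  iff  ∀ ε > 0. ∃ K. ∀ k ≥ K. c - ε < a k
--   L > c  iff  ∃ δ > 0. ∃ K. ∀ k ≥ K. c + δ ≤ a k

LimGe : (ℕ → ℚ) → ℚ → Set
LimGe a c = ∀ (ε : ℚ) → 0ℚ < ε → ∃[ K ] (∀ k → K ℕ.≤ k → c - ε < a k)

LimGt : (ℕ → ℚ) → ℚ → Set
LimGt a c = ∃[ δ ] (0ℚ < δ × ∃[ K ] (∀ k → K ℕ.≤ k → c + δ ≤ a k))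

DT : (ℕ → ℕ) → Set
DT f = Σ (Tm [] (nat ⇒ nat)) λ M → PlusFree M ×
         (∀ n → ∃[ k ] (evalStep k (app M (num n)) ≡ dirac (num (f n))))

twoThirds : ℚ
twoThirds = + 2 / 3

BP : (ℕ → ℕ) → Set
BP f = Σ (Tm [] (nat ⇒ nat)) λ M →
         ∀ n → LimGe (prob (f n) (app M (num n))) twoThirds

PrC : (ℕ → ℕ) → Set
PrC f = Σ (Tm [] (nat ⇒ nat)) λ M →
          ∀ n → LimGt (prob (f n) (app M (num n))) ½

-- 1/m (only used for m ≠ 0)
recip : ℕ → ℚ
recip zero    = 0ℚ
recip (suc m) = + 1 / suc m

BPf : (ℕ → ℕ) → Set
BPf f = Σ (ℕ → ℕ) λ h → DT h × (∀ n → h n ≢ 0) ×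
          Σ (Tm [] (nat ⇒ nat)) λ M →
            ∀ n → LimGt (prob (f n) (app M (num n))) (½ + recip (h n))

{-# OPTIONS --safe #-}

-- A closed term M : nat ⇒ nat applied to a numeral denotes a finite tree of coin tosses whose
-- leaves are its outcomes.  A CPS translation into System T folds any merging operation over this
-- tree.  Merging is done by Boyer–Moore majority voting: a subtree is summarised by a candidate,
-- its margin and the total weight, and two summaries with different candidates keep the heavier
-- candidate with the difference of the (rescaled) margins.  The candidate at the root is then the
-- only outcome that can have probability above one half; no lower bound on the excess over one
-- half is needed.

module Submission where

open import Defs
open import Algebra.Bundles using (CommutativeRing)
open import Data.Integer using (+_)
open import Data.List using ([]; _∷_; _++_)
open import Data.List.Properties using (concatMap-++)
open import Data.Maybe using (Maybe; just; nothing; map; zipWith; from-just)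
open import Data.Nat as ℕ using (ℕ; zero; suc; _∸_; _⊔_; _≟_; pred; z≤n; s≤s)
import Data.Nat.Properties as ℕₚ
import Data.Nat.Solver as ℕ-Solver
open import Data.Product using (_×_; _,_; ∃-syntax; proj₁; proj₂)
open import Data.Rational as ℚ using (ℚ; _/_; 0ℚ; 1ℚ; ½; _+_; _*_; _-_; _<_; _≤_)
import Data.Rational.Properties as ℚₚ
import Data.Rational.Solver as ℚ-Solver
open import Algebra.Properties.Semiring.Mult (CommutativeRing.semiring ℚₚ.+-*-commutativeRing)
  using (×-homo-+; ×1-homo-*) renaming (_×_ to _·_)
open import Data.Sum using (_⊎_; inj₁; inj₂)
open import Function.Bundles using (_⇔_; mk⇔)
open import Relation.Nullary using (Dec; yes; no; contradiction)
open import Relation.Nullary.Decidable using (from-yes)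
open import Relation.Binary.PropositionalEquality as ≡
  using (_≡_; _≢_; refl; sym; trans; cong; cong₂)

-- Renaming and substitution

rename-cong : ∀ {Γ Δ} {ρ ρ′ : Ren Γ Δ} → (∀ {σ} (x : Γ ∋ σ) → ρ x ≡ ρ′ x) →
              ∀ {σ} (M : Tm Γ σ) → rename ρ M ≡ rename ρ′ M
rename-cong e (var x)    = cong var (e x)
rename-cong e (lam M)    = cong lam
  (rename-cong (λ { here → refl ; (there x) → cong there (e x) }) M)
rename-cong e (app M N)  = cong₂ app (rename-cong e M) (rename-cong e N)
rename-cong e (pair M N) = cong₂ pair (rename-cong e M) (rename-cong e N)
rename-cong e π₁         = refl
rename-cong e π₂         = refl
rename-cong e rec        = refl
rename-cong e zer        = refl
rename-cong e suc'       = refl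
rename-cong e (M ⊕ N)    = cong₂ _⊕_ (rename-cong e M) (rename-cong e N)

subst-cong : ∀ {Γ Δ} {s s′ : Sub Γ Δ} → (∀ {σ} (x : Γ ∋ σ) → s x ≡ s′ x) →
             ∀ {σ} (M : Tm Γ σ) → subst s M ≡ subst s′ M
subst-cong e (var x)    = e x
subst-cong e (lam M)    = cong lam
  (subst-cong (λ { here → refl ; (there x) → cong (rename there) (e x) }) M)
subst-cong e (app M N)  = cong₂ app (subst-cong e M) (subst-cong e N)
subst-cong e (pair M N) = cong₂ pair (subst-cong e M) (subst-cong e N)
subst-cong e π₁         = refl
subst-cong e π₂         = refl
subst-cong e rec        = refl
subst-cong e zer        = refl
subst-cong e suc'       = refl
subst-cong e (M ⊕ N)    = cong₂ _⊕_ (subst-cong e M) (subst-cong e N)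

subst-var : ∀ {Γ σ} (M : Tm Γ σ) → subst var M ≡ M
subst-var (var x)    = refl
subst-var (lam M)    = cong lam
  (trans (subst-cong (λ { here → refl ; (there x) → refl }) M) (subst-var M))
subst-var (app M N)  = cong₂ app (subst-var M) (subst-var N)
subst-var (pair M N) = cong₂ pair (subst-var M) (subst-var N)
subst-var π₁         = refl
subst-var π₂         = refl
subst-var rec        = refl
subst-var zer        = refl
subst-var suc'       = refl
subst-var (M ⊕ N)    = cong₂ _⊕_ (subst-var M) (subst-var N)

rename-rename : ∀ {Γ Δ Θ} (ρ : Ren Γ Δ) (ρ′ : Ren Δ Θ) {σ} (M : Tm Γ σ) →
                rename ρ′ (rename ρ M) ≡ rename (λ x → ρ′ (ρ x)) M
rename-rename ρ ρ′ (var x)    = refl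
rename-rename ρ ρ′ (lam M)    = cong lam
  (trans (rename-rename (ext ρ) (ext ρ′) M)
         (rename-cong (λ { here → refl ; (there x) → refl }) M))
rename-rename ρ ρ′ (app M N)  = cong₂ app (rename-rename ρ ρ′ M) (rename-rename ρ ρ′ N)
rename-rename ρ ρ′ (pair M N) = cong₂ pair (rename-rename ρ ρ′ M) (rename-rename ρ ρ′ N)
rename-rename ρ ρ′ π₁         = refl
rename-rename ρ ρ′ π₂         = refl
rename-rename ρ ρ′ rec        = refl
rename-rename ρ ρ′ zer        = refl
rename-rename ρ ρ′ suc'       = refl
rename-rename ρ ρ′ (M ⊕ N)    = cong₂ _⊕_ (rename-rename ρ ρ′ M) (rename-rename ρ ρ′ N)

subst-rename : ∀ {Γ Δ Θ} (ρ : Ren Γ Δ) (s : Sub Δ Θ) {σ} (M : Tm Γ σ) →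
               subst s (rename ρ M) ≡ subst (λ x → s (ρ x)) M
subst-rename ρ s (var x)    = refl
subst-rename ρ s (lam M)    = cong lam
  (trans (subst-rename (ext ρ) (exts s) M)
         (subst-cong (λ { here → refl ; (there x) → refl }) M))
subst-rename ρ s (app M N)  = cong₂ app (subst-rename ρ s M) (subst-rename ρ s N)
subst-rename ρ s (pair M N) = cong₂ pair (subst-rename ρ s M) (subst-rename ρ s N)
subst-rename ρ s π₁         = refl
subst-rename ρ s π₂         = refl
subst-rename ρ s rec        = refl
subst-rename ρ s zer        = refl
subst-rename ρ s suc'       = refl
subst-rename ρ s (M ⊕ N)    = cong₂ _⊕_ (subst-rename ρ s M) (subst-rename ρ s N)

rename-subst : ∀ {Γ Δ Θ} (s : Sub Γ Δ) (ρ : Ren Δ Θ) {σ} (M : Tm Γ σ) →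
               rename ρ (subst s M) ≡ subst (λ x → rename ρ (s x)) M
rename-subst s ρ (var x)    = refl
rename-subst s ρ (lam M)    = cong lam
  (trans (rename-subst (exts s) (ext ρ) M)
         (subst-cong (λ { here → refl
                        ; (there x) → trans (rename-rename there (ext ρ) (s x))
                                            (sym (rename-rename ρ there (s x))) }) M))
rename-subst s ρ (app M N)  = cong₂ app (rename-subst s ρ M) (rename-subst s ρ N)
rename-subst s ρ (pair M N) = cong₂ pair (rename-subst s ρ M) (rename-subst s ρ N)
rename-subst s ρ π₁         = refl
rename-subst s ρ π₂         = refl
rename-subst s ρ rec        = refl
rename-subst s ρ zer        = refl
rename-subst s ρ suc'       = refl
rename-subst s ρ (M ⊕ N)    = cong₂ _⊕_ (rename-subst s ρ M) (rename-subst s ρ N)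

subst-subst : ∀ {Γ Δ Θ} (s : Sub Γ Δ) (s′ : Sub Δ Θ) {σ} (M : Tm Γ σ) →
              subst s′ (subst s M) ≡ subst (λ x → subst s′ (s x)) M
subst-subst s s′ (var x)    = refl
subst-subst s s′ (lam M)    = cong lam
  (trans (subst-subst (exts s) (exts s′) M)
         (subst-cong (λ { here → refl
                        ; (there x) → trans (subst-rename there (exts s′) (s x))
                                            (sym (rename-subst s′ there (s x))) }) M))
subst-subst s s′ (app M N)  = cong₂ app (subst-subst s s′ M) (subst-subst s s′ N)
subst-subst s s′ (pair M N) = cong₂ pair (subst-subst s s′ M) (subst-subst s s′ N)
subst-subst s s′ π₁         = refl
subst-subst s s′ π₂         = refl
subst-subst s s′ rec        = refl
subst-subst s s′ zer        = refl
subst-subst s s′ suc'       = refl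
subst-subst s s′ (M ⊕ N)    = cong₂ _⊕_ (subst-subst s s′ M) (subst-subst s s′ N)

infixl 5 _▹_

_▹_ : ∀ {Γ Δ σ} → Sub Γ Δ → Tm Δ σ → Sub (σ ∷ Γ) Δ
(s ▹ V) here      = V
(s ▹ V) (there x) = s x

subst-exts-[] : ∀ {Γ Δ σ τ} (s : Sub Γ Δ) (V : Tm Δ σ) (M : Tm (σ ∷ Γ) τ) →
                subst (exts s) M [ V ] ≡ subst (s ▹ V) M
subst-exts-[] s V M =
  -- The substitution inside `_[_]` is local to its definition, so it is matched with `var ▹ V`
  -- pointwise.
  trans (subst-cong {s′ = var ▹ V} (λ { here → refl ; (there x) → refl }) (subst (exts s) M))
  (trans (subst-subst (exts s) (var ▹ V) M)
         (subst-cong (λ { here → refl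
                        ; (there x) → trans (subst-rename there (var ▹ V) (s x))
                                            (subst-var (s x)) }) M))

-- Denotational semantics in coin-toss trees

data Tree (A : Set) : Set where
  leaf : A → Tree A
  node : Tree A → Tree A → Tree A

infixl 4 _>>=_

_>>=_ : ∀ {A B} → Tree A → (A → Tree B) → Tree B
leaf a   >>= k = k a
node l r >>= k = node (l >>= k) (r >>= k)

-- Kleisli semantics for the tree monad: a value tosses coins only when applied. Finite trees
-- suffice because every term terminates.
⟦_⟧ₜ : Ty → Set
⟦ nat ⟧ₜ    = ℕ
⟦ σ ⇒ τ ⟧ₜ  = ⟦ σ ⟧ₜ → Tree ⟦ τ ⟧ₜ
⟦ σ ×ₜ τ ⟧ₜ = ⟦ σ ⟧ₜ × ⟦ τ ⟧ₜ

Env : Ctx → Set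
Env Γ = ∀ {σ} → Γ ∋ σ → ⟦ σ ⟧ₜ

∅ : Env []
∅ ()

infixl 5 _▸_

_▸_ : ∀ {Γ σ} → Env Γ → ⟦ σ ⟧ₜ → Env (σ ∷ Γ)
(η ▸ d) here      = d
(η ▸ d) (there x) = η x

-- The recursive call is sequenced before `v n` because `step` reduces the argument of an
-- application before its function.
recTree : ∀ {A : Set} → A × (ℕ → Tree (A → Tree A)) × ℕ → Tree A
recTree (u , v , zero)  = leaf u
recTree (u , v , suc n) = recTree (u , v , n) >>= λ r → v n >>= λ g → g r

⟦_⟧ : ∀ {Γ σ} → Tm Γ σ → Env Γ → Tree ⟦ σ ⟧ₜ
⟦ var x ⟧ η    = leaf (η x)
⟦ lam M ⟧ η    = leaf (λ d → ⟦ M ⟧ (η ▸ d))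
⟦ app M N ⟧ η  = ⟦ N ⟧ η >>= λ d → ⟦ M ⟧ η >>= λ f → f d
⟦ pair M N ⟧ η = ⟦ M ⟧ η >>= λ a → ⟦ N ⟧ η >>= λ b → leaf (a , b)
⟦ π₁ ⟧ η       = leaf (λ p → leaf (proj₁ p))
⟦ π₂ ⟧ η       = leaf (λ p → leaf (proj₂ p))
⟦ rec ⟧ η      = leaf recTree
⟦ zer ⟧ η      = leaf 0
⟦ suc' ⟧ η     = leaf (λ n → leaf (suc n))
⟦ M ⊕ N ⟧ η    = node (⟦ M ⟧ η) (⟦ N ⟧ η)

-- Adequacy

data Value {σ} (V : Tm [] σ) : Set where
  irreducible : step V ≡ nothing → Value V

-- Derivations are finite, so `Eval` includes termination on every branch. Deterministic steps leave
-- no trace in the tree; its nodes are exactly the tosses.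
data Eval {σ A} (P : Tm [] σ → A → Set) : Tm [] σ → Tree A → Set where
  done : ∀ {V d} → Value V → P V d → Eval P V (leaf d)
  det  : ∀ {M M′ t} → step M ≡ just (dirac M′) → Eval P M′ t → Eval P M t
  toss : ∀ {M M₁ M₂ t₁ t₂} → step M ≡ just ((½ , M₁) ∷ (½ , M₂) ∷ []) →
         Eval P M₁ t₁ → Eval P M₂ t₂ → Eval P M (node t₁ t₂)

EvalCtx : ∀ {σ τ} → (Tm [] σ → Tm [] τ) → Set
EvalCtx C = ∀ M {μ} → step M ≡ just μ → step (C M) ≡ just (mapD C μ)

-- The reductions of `M` are replayed inside `C`, and what happens after `M` has become a value is
-- grafted onto the leaves.
Eval-bind : ∀ {σ τ A B} {P : Tm [] σ → A → Set} {Q : Tm [] τ → B → Set}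
            {C : Tm [] σ → Tm [] τ} {k : A → Tree B} → EvalCtx C →
            (∀ {V d} → Value V → P V d → Eval Q (C V) (k d)) →
            ∀ {M t} → Eval P M t → Eval Q (C M) (t >>= k)
Eval-bind c h (done v p)   = h v p
Eval-bind c h (det e E)    = det (c _ e) (Eval-bind c h E)
Eval-bind c h (toss e E F) = toss (c _ e) (Eval-bind c h E) (Eval-bind c h F)

ctx-app₂ : ∀ {σ τ} {M : Tm [] (σ ⇒ τ)} → EvalCtx (app M)
ctx-app₂ _ e rewrite e = refl

ctx-app₁ : ∀ {σ τ} {V : Tm [] σ} → Value V → EvalCtx {σ ⇒ τ} (λ M → app M V)
ctx-app₁ (irreducible v) _ e rewrite v | e = refl

ctx-pair₁ : ∀ {σ τ} {N : Tm [] τ} → EvalCtx {σ} (λ M → pair M N)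
ctx-pair₁ _ e rewrite e = refl

ctx-pair₂ : ∀ {σ τ} {V : Tm [] σ} → Value V → EvalCtx {τ} (pair V)
ctx-pair₂ (irreducible v) _ e rewrite v | e = refl

-- A Tait-style logical relation between closed values and denotations; termination is built into
-- its arrow clause through `Eval`.
Val : ∀ σ → Tm [] σ → ⟦ σ ⟧ₜ → Set
Val nat V n            = V ≡ num n
Val (σ ⇒ τ) V f        = ∀ {W d} → Value W → Val σ W d → Eval (Val τ) (app V W) (f d)
Val (σ ×ₜ τ) V (d , e) = ∃[ V₁ ] ∃[ V₂ ] V ≡ pair V₁ V₂ ×
  (Value V₁ × Val σ V₁ d) × (Value V₂ × Val τ V₂ e)

value-num : ∀ n → Value (num n)
value-num zero = irreducible refl
value-num (suc n) with value-num n
... | irreducible v = irreducible step-suc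
  where
  step-suc : step (app suc' (num n)) ≡ nothing
  step-suc rewrite v = refl

value-pair : ∀ {σ τ} {V : Tm [] σ} {W : Tm [] τ} → Value V → Value W → Value (pair V W)
value-pair {V = V} {W} (irreducible v) (irreducible w) = irreducible step-pair
  where
  step-pair : step (pair V W) ≡ nothing
  step-pair rewrite v | w = refl

step-contract : ∀ {σ τ} {V : Tm [] (σ ⇒ τ)} {W : Tm [] σ} →
                Value V → Value W → step (app V W) ≡ contract V W
step-contract (irreducible v) (irreducible w) rewrite w | v = refl

Eval-app : ∀ {σ τ} {M : Tm [] (σ ⇒ τ)} {N : Tm [] σ} {s t} →
           Eval (Val (σ ⇒ τ)) M s → Eval (Val σ) N t →
           Eval (Val τ) (app M N) (t >>= λ d → s >>= λ f → f d)
Eval-app EM EN = Eval-bind ctx-app₂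
  (λ v p → Eval-bind (ctx-app₁ v) (λ _ f → f v p) EM) EN

Eval-rec : ∀ {σ} {U V u v} → Value U → Val σ U u →
           Value V → Val (nat ⇒ σ ⇒ σ) V v → ∀ n →
           Eval (Val σ) (app rec (pair U (pair V (num n)))) (recTree (u , v , n))
Eval-rec U↓ u V↓ v zero =
  det (step-contract {V = rec} (irreducible refl) (value-pair U↓ (value-pair V↓ (value-num 0))))
      (done U↓ u)
Eval-rec U↓ u V↓ v (suc n) =
  det (step-contract {V = rec} (irreducible refl) (value-pair U↓ (value-pair V↓ (value-num (suc n)))))
      (Eval-app (v (value-num n) refl) (Eval-rec U↓ u V↓ v n))

ValSub : ∀ {Γ} → Sub Γ [] → Env Γ → Set
ValSub {Γ} s η = ∀ {σ} (x : Γ ∋ σ) → Value (s x) × Val σ (s x) (η x)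

-- Fundamental lemma of `Val`, by induction on the term under closing substitutions; a β-step
-- extends substitution and environment together.
adequacy : ∀ {Γ σ} (M : Tm Γ σ) {s : Sub Γ []} {η : Env Γ} → ValSub s η →
           Eval (Val σ) (subst s M) (⟦ M ⟧ η)
adequacy (var x) γ = done (proj₁ (γ x)) (proj₂ (γ x))
adequacy (lam M) {s} {η} γ = done (irreducible refl) λ {W} {d} w p →
  det (step-contract {V = lam (subst (exts s) M)} (irreducible refl) w)
      (≡.subst (λ N → Eval _ N _) (sym (subst-exts-[] s W M))
        (adequacy M {s ▹ W} {η ▸ d} λ { here → w , p ; (there x) → γ x }))
adequacy (app M N) γ = Eval-app (adequacy M γ) (adequacy N γ)
adequacy (pair M N) γ = Eval-bind ctx-pair₁
  (λ v p → Eval-bind (ctx-pair₂ v)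
    (λ w q → done (value-pair v w) (_ , _ , refl , (v , p) , (w , q)))
    (adequacy N γ))
  (adequacy M γ)
adequacy π₁ γ = done (irreducible refl) λ where
  w (_ , _ , refl , (v , p) , _) → det (step-contract {V = π₁} (irreducible refl) w) (done v p)
adequacy π₂ γ = done (irreducible refl) λ where
  w (_ , _ , refl , _ , (v , p)) → det (step-contract {V = π₂} (irreducible refl) w) (done v p)
adequacy rec γ = done (irreducible refl) λ
  { {d = _ , _ , n} w (_ , _ , refl , (u↓ , u) , (_ , (_ , _ , refl , (v↓ , v) , (_ , refl)))) →
    Eval-rec u↓ u v↓ v n }
adequacy zer γ = done (irreducible refl) refl
-- `suc'` applied to a numeral is already a value, so no contraction takes place.
adequacy suc' γ = done (irreducible refl) λ { {d = n} w refl →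
  done (value-num (suc n)) refl }
adequacy (M ⊕ N) γ = toss refl (adequacy M γ) (adequacy N γ)

adequacy-closed : ∀ {σ} (M : Tm [] σ) → Eval (Val σ) M (⟦ M ⟧ ∅)
adequacy-closed M = ≡.subst (λ N → Eval _ N (⟦ M ⟧ ∅))
  (trans (subst-cong {s = λ ()} {s′ = var} (λ ()) M) (subst-var M))
  (adequacy M (λ ()))

Eval-app-num : (M : Tm [] (nat ⇒ nat)) → ∀ n →
               Eval (Val nat) (app M (num n)) (⟦ M ⟧ ∅ >>= λ f → f n)
Eval-app-num M n = Eval-app (adequacy-closed M) (done (value-num n) refl)

-- Small-step evaluation of distributions

-- Unlike `evalStep`, this exposes the first step rather than the last, as induction on `Eval`
-- derivations requires.
run : ∀ {σ} → ℕ → Dist σ → Dist σ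
run zero    D = D
run (suc k) D = run k (stepD D)

stepD-run : ∀ {σ} k (D : Dist σ) → stepD (run k D) ≡ run k (stepD D)
stepD-run zero    D = refl
stepD-run (suc k) D = stepD-run k (stepD D)

evalStep≡run : ∀ {σ} k (M : Tm [] σ) → evalStep k M ≡ run k (dirac M)
evalStep≡run zero    M = refl
evalStep≡run (suc k) M = trans (cong stepD (evalStep≡run k M)) (stepD-run k (dirac M))

run-++ : ∀ {σ} k (D E : Dist σ) → run k (D ++ E) ≡ run k D ++ run k E
run-++ zero    D E = refl
run-++ (suc k) D E = trans (cong (run k) (concatMap-++ _ D E)) (run-++ k (stepD D) (stepD E))

run-value : ∀ {σ} k p {V : Tm [] σ} → Value V → run k ((p , V) ∷ []) ≡ (p , V) ∷ []
run-value zero    p v = refl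
run-value (suc k) p {V} (irreducible v) =
  trans (cong (run k) stepD-value) (run-value k p (irreducible v))
  where
  stepD-value : stepD ((p , V) ∷ []) ≡ (p , V) ∷ []
  stepD-value rewrite v = refl

dist : ℚ → Tree ℕ → Dist nat
dist p (leaf n)   = (p , num n) ∷ []
dist p (node l r) = dist (p * ½) l ++ dist (p * ½) r

-- The initial weight is arbitrary because each toss halves it. Values are kept by `stepD`, so a
-- settled branch can wait for the slower one: the bound at a toss is the maximum of both, plus the
-- toss itself.
run-dist : ∀ {M t} → Eval (Val nat) M t → ∀ p →
           ∃[ K ] (∀ k → K ℕ.≤ k → run k ((p , M) ∷ []) ≡ dist p t)
run-dist (done v refl) p = 0 , λ k _ → run-value k p v
run-dist (det {M} {M′} e E) p with run-dist E p
... | K , h = suc K , λ { (suc k) (s≤s K≤k) → trans (cong (run k) stepD-det) (h k K≤k) }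
  where
  stepD-det : stepD ((p , M) ∷ []) ≡ (p , M′) ∷ []
  stepD-det rewrite e = cong (λ q → (q , M′) ∷ []) (ℚₚ.*-identityʳ p)
run-dist (toss {M} {M₁} {M₂} e E F) p with run-dist E (p * ½) | run-dist F (p * ½)
... | K , h | L , h′ = suc (K ⊔ L) , λ { (suc k) (s≤s KL≤k) →
    trans (cong (run k) stepD-toss)
    (trans (run-++ k ((p * ½ , M₁) ∷ []) ((p * ½ , M₂) ∷ []))
    (cong₂ _++_ (h k (ℕₚ.m⊔n≤o⇒m≤o K L KL≤k)) (h′ k (ℕₚ.m⊔n≤o⇒n≤o K L KL≤k)))) }
  where
  stepD-toss : stepD ((p , M) ∷ []) ≡ (p * ½ , M₁) ∷ (p * ½ , M₂) ∷ []
  stepD-toss rewrite e = refl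

evalStep-dist : ∀ {M t} → Eval (Val nat) M t →
                ∃[ K ] (∀ k → K ℕ.≤ k → evalStep k M ≡ dist 1ℚ t)
evalStep-dist {M} E with run-dist E 1ℚ
... | K , h = K , λ k K≤k → trans (evalStep≡run k M) (h k K≤k)

-- Arithmetic in System T

-- Wrapping the equation in a record keeps `η`, `M` and `d` visible to unification, where `⟦ M ⟧ η`
-- alone would unfold.
record _⊢_↦_ {Γ σ} (η : Env Γ) (M : Tm Γ σ) (d : ⟦ σ ⟧ₜ) : Set where
  constructor returns
  field equation : ⟦ M ⟧ η ≡ leaf d

open _⊢_↦_

-- Each arithmetic program below is a recursor whose result has a closed form `F`; only the base and
-- the step of `F` remain to be checked.
recTree-leaf : ∀ {A : Set} {u : A} {v : ℕ → Tree (A → Tree A)} (F : ℕ → A) → u ≡ F 0 →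
               (∀ n → (v n >>= λ g → g (F n)) ≡ leaf (F (suc n))) →
               ∀ n → recTree (u , v , n) ≡ leaf (F n)
recTree-leaf F z s zero = cong leaf z
recTree-leaf {v = v} F z s (suc n) =
  trans (cong (_>>= λ r → v n >>= λ g → g r) (recTree-leaf F z s n)) (s n)

v₀ : ∀ {Γ σ} → Tm (σ ∷ Γ) σ
v₀ = var here

v₁ : ∀ {Γ σ τ} → Tm (σ ∷ τ ∷ Γ) τ
v₁ = var (there here)

v₂ : ∀ {Γ σ τ υ} → Tm (σ ∷ τ ∷ υ ∷ Γ) υ
v₂ = var (there (there here))

v₃ : ∀ {Γ σ τ υ φ} → Tm (σ ∷ τ ∷ υ ∷ φ ∷ Γ) φ
v₃ = var (there (there (there here)))

one : ∀ {Γ} → Tm Γ nat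
one = app suc' zer

predecessor : ∀ {Γ} → Tm Γ nat → Tm Γ nat
predecessor a = app rec (pair zer (pair (lam (lam v₁)) a))

-- The arguments are passed to a closed λ-term, which avoids weakening them under the binders of the
-- step function.
add mul monus : ∀ {Γ} → Tm Γ nat → Tm Γ nat → Tm Γ nat
add a b = app (app (lam (lam (app rec (pair v₀ (pair (lam (lam (app suc' v₀))) v₁))))) a) b
mul a b = app (app (lam (lam (app rec (pair zer (pair (lam (lam (add v₂ v₀))) v₁))))) a) b
monus a b = app (app (lam (lam (app rec (pair v₁ (pair (lam (lam (predecessor v₀))) v₀))))) a) b

ifZero : ∀ {Γ} → Tm Γ nat → Tm Γ nat → Tm Γ nat → Tm Γ nat
ifZero a b c = app (app (app (lam (lam (lam (app rec (pair v₁ (pair (lam (lam v₂)) v₂)))))) a) b) c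

ifZeroℕ : ℕ → ℕ → ℕ → ℕ
ifZeroℕ zero    b c = b
ifZeroℕ (suc _) b c = c

module _ {Γ} {η : Env Γ} {A B : Tm Γ nat} {a b : ℕ} (A↦ : η ⊢ A ↦ a) (B↦ : η ⊢ B ↦ b) where

  add↦ : η ⊢ add A B ↦ (a ℕ.+ b)
  add↦ .equation rewrite A↦ .equation | B↦ .equation =
    recTree-leaf (ℕ._+ b) refl (λ _ → refl) a

  monus↦ : η ⊢ monus A B ↦ (a ∸ b)
  monus↦ .equation rewrite A↦ .equation | B↦ .equation = recTree-leaf (a ∸_) refl
    (λ n → trans (recTree-leaf pred refl (λ _ → refl) (a ∸ n))
                 (cong leaf (ℕₚ.pred[m∸n]≡m∸[1+n] a n))) b

mul↦ : ∀ {Γ} {η : Env Γ} {A B : Tm Γ nat} {a b : ℕ} →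
       η ⊢ A ↦ a → η ⊢ B ↦ b → η ⊢ mul A B ↦ (a ℕ.* b)
mul↦ {η = η} {a = a} {b} A↦ B↦ .equation rewrite A↦ .equation | B↦ .equation =
  recTree-leaf (ℕ._* b) refl
    (λ n → add↦ {η = η ▸ a ▸ b ▸ n ▸ n ℕ.* b} {v₂} {v₀} (returns refl) (returns refl) .equation) a

ifZero↦ : ∀ {Γ} {η : Env Γ} {A B C : Tm Γ nat} {a b c : ℕ} →
          η ⊢ A ↦ a → η ⊢ B ↦ b → η ⊢ C ↦ c → η ⊢ ifZero A B C ↦ ifZeroℕ a b c
ifZero↦ {a = a} {b} {c} A↦ B↦ C↦ .equation
  rewrite A↦ .equation | B↦ .equation | C↦ .equation =
  recTree-leaf (λ n → ifZeroℕ n b c) refl (λ _ → refl) a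

fst : ∀ {Γ σ τ} → Tm Γ (σ ×ₜ τ) → Tm Γ σ
fst = app π₁

snd : ∀ {Γ σ τ} → Tm Γ (σ ×ₜ τ) → Tm Γ τ
snd = app π₂

-- CPS translation of T⊕ into System T

Poll : Ty
Poll = nat ×ₜ (nat ×ₜ nat)

winner margin total : ∀ {Γ} → Tm Γ Poll → Tm Γ nat
winner r = fst r
margin r = fst (snd r)
total  r = snd (snd r)

-- The margins a/d and b/e are brought to the denominator 2de; the factor 2 is the coin toss.
merge : ⟦ Poll ⟧ₜ → ⟦ Poll ⟧ₜ → ⟦ Poll ⟧ₜ
merge (v , a , d) (w , b , e) =
    ifZeroℕ (a ℕ.* e ∸ b ℕ.* d) w v
  , ifZeroℕ ((v ∸ w) ℕ.+ (w ∸ v))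
      (a ℕ.* e ℕ.+ b ℕ.* d)
      ((a ℕ.* e ∸ b ℕ.* d) ℕ.+ (b ℕ.* d ∸ a ℕ.* e))
  , d ℕ.* e ℕ.+ d ℕ.* e

mergeBody : ∀ {Γ} → Tm (Poll ∷ Poll ∷ Γ) Poll
mergeBody = pair
  (ifZero (monus ae bd) (winner v₀) (winner v₁))
  (pair
    (ifZero (add (monus (winner v₁) (winner v₀)) (monus (winner v₀) (winner v₁)))
      (add ae bd)
      (add (monus ae bd) (monus bd ae)))
    (add de de))
  where
  ae = mul (margin v₁) (total v₀)
  bd = mul (margin v₀) (total v₁)
  de = mul (total v₁) (total v₀)

mergeT : ∀ {Γ} → Tm Γ Poll → Tm Γ Poll → Tm Γ Poll
mergeT R S = app (app (lam (lam mergeBody)) R) S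

pair↦ : ∀ {Γ σ τ} {η : Env Γ} {A : Tm Γ σ} {B : Tm Γ τ} {a b} →
        η ⊢ A ↦ a → η ⊢ B ↦ b → η ⊢ pair A B ↦ (a , b)
pair↦ A↦ B↦ .equation rewrite A↦ .equation | B↦ .equation = refl

mergeBody↦ : ∀ {Γ} {η : Env Γ} {r s} → (η ▸ r ▸ s) ⊢ mergeBody ↦ merge r s
mergeBody↦ =
  pair↦ (ifZero↦ (monus↦ ae bd) w v)
    (pair↦
      (ifZero↦ (add↦ (monus↦ v w) (monus↦ w v))
               (add↦ ae bd) (add↦ (monus↦ ae bd) (monus↦ bd ae)))
      (add↦ de de))
  where
  v  = returns refl
  w  = returns refl
  ae = mul↦ (returns refl) (returns refl)
  bd = mul↦ (returns refl) (returns refl)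
  de = mul↦ (returns refl) (returns refl)

mergeT↦ : ∀ {Γ} {η : Env Γ} {R S : Tm Γ Poll} {r s} →
          η ⊢ R ↦ r → η ⊢ S ↦ s → η ⊢ mergeT R S ↦ merge r s
mergeT↦ {η = η} {r = r} {s} R↦ S↦ .equation rewrite R↦ .equation | S↦ .equation =
  mergeBody↦ {η = η} {r} {s} .equation

fold : ∀ {A R : Set} → (R → R → R) → (A → R) → Tree A → R
fold _∙_ κ (leaf a)   = κ a
fold _∙_ κ (node l r) = fold _∙_ κ l ∙ fold _∙_ κ r

-- The law that makes the CPS translation correct: a continuation that itself folds accounts for one
-- `>>=`.
fold->>= : ∀ {A B R : Set} {_∙_ : R → R → R} {κ : B → R} {f : A → Tree B} (t : Tree A) →
           fold _∙_ (λ a → fold _∙_ κ (f a)) t ≡ fold _∙_ κ (t >>= f)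
fold->>= (leaf a) = refl
fold->>= {_∙_ = _∙_} (node l r) = cong₂ _∙_ (fold->>= l) (fold->>= r)

-- Call-by-value CPS with answer type `Poll`. System T has no type of trees, so a computation is
-- represented by its fold: it receives the poll of each leaf as a function and returns the merged
-- poll.
cps : Ty → Ty

Comp : Ty → Ty
Comp σ = (cps σ ⇒ Poll) ⇒ Poll

cps nat      = nat
cps (σ ⇒ τ)  = cps σ ⇒ (cps τ ⇒ Poll) ⇒ Poll
cps (σ ×ₜ τ) = cps σ ×ₜ cps τ

CRen : Ctx → Ctx → Set
CRen Γ Δ = ∀ {σ} → Γ ∋ σ → Δ ∋ cps σ

wk : ∀ {Γ Δ σ} → CRen Γ Δ → CRen Γ (σ ∷ Δ)
wk ρ x = there (ρ x)

lift : ∀ {Γ Δ σ} → CRen Γ Δ → CRen (σ ∷ Γ) (cps σ ∷ Δ)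
lift ρ here      = here
lift ρ (there x) = there (ρ x)

bind : ∀ {Γ σ} → Tm ((σ ⇒ Poll) ∷ Γ) Poll → Tm (σ ∷ Γ) Poll → Tm Γ Poll
bind C K = app (lam C) (lam K)

-- rec ⟨λk. k u, ⟨λn r k. r (λx. v n (λg. g x k)), n⟩⟩ for the argument ⟨u, ⟨v, n⟩⟩
recCPS : ∀ {Γ} σ → Tm (cps (σ ×ₜ ((nat ⇒ σ ⇒ σ) ×ₜ nat)) ∷ Γ) (Comp σ)
recCPS σ = app rec (pair
  (lam (app v₀ (fst v₁)))
  (pair
    (lam (lam (lam (app v₁ (lam (app (app (fst (snd (var (there (there (there (there here))))))) v₃)
                                     (lam (app (app v₀ v₁) v₂))))))))
    (snd (snd v₀))))

-- The continuation is always a variable: going under a binder only renames it, and `⊕` can use it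
-- in both branches. `⊕` is the one place where polls are merged.
compile : ∀ {Γ Δ σ} → Tm Γ σ → CRen Γ Δ → Δ ∋ (cps σ ⇒ Poll) → Tm Δ Poll
compile (var x) ρ k    = app (var k) (var (ρ x))
compile (lam M) ρ k    = app (var k) (lam (lam (compile M (wk (lift ρ)) here)))
compile (app M N) ρ k  =
  bind (compile N (wk ρ) here)
    (bind (compile M (wk (wk ρ)) here)
      (app (app v₀ v₁) (var (there (there k)))))
compile (pair M N) ρ k =
  bind (compile M (wk ρ) here)
    (bind (compile N (wk (wk ρ)) here)
      (app (var (there (there k))) (pair v₁ v₀)))
compile π₁ ρ k         = app (var k) (lam (lam (app v₀ (fst v₁))))
compile π₂ ρ k         = app (var k) (lam (lam (app v₀ (snd v₁))))
compile (rec {σ}) ρ k  = app (var k) (lam (recCPS σ))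
compile zer ρ k        = app (var k) zer
compile suc' ρ k       = app (var k) (lam (lam (app v₀ (app suc' v₁))))
compile (M ⊕ N) ρ k    = mergeT (compile M ρ k) (compile N ρ k)

-- Correctness of the translation by a logical relation

-- Computations are compared through all pairs of related continuations. The `leaf` on the
-- translated side says that the System T program tosses no coin.
Sim : ∀ σ → ⟦ σ ⟧ₜ → ⟦ cps σ ⟧ₜ → Set

SimCont : ∀ σ → (⟦ σ ⟧ₜ → ⟦ Poll ⟧ₜ) → ⟦ cps σ ⇒ Poll ⟧ₜ → Set
SimCont σ κ g = ∀ d d′ → Sim σ d d′ → g d′ ≡ leaf (κ d)

SimComp : ∀ σ → Tree ⟦ σ ⟧ₜ → ⟦ Comp σ ⟧ₜ → Set
SimComp σ t h = ∀ κ g → SimCont σ κ g → h g ≡ leaf (fold merge κ t)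

Sim nat n n′                   = n ≡ n′
Sim (σ ⇒ τ) f f′               = ∀ d d′ → Sim σ d d′ → ∃[ h ] f′ d′ ≡ leaf h × SimComp τ (f d) h
Sim (σ ×ₜ τ) (d , e) (d′ , e′) = Sim σ d d′ × Sim τ e e′

Sim-apply : ∀ {σ τ f f′ d d′ κ g} → Sim (σ ⇒ τ) f f′ → Sim σ d d′ → SimCont τ κ g →
            (f′ d′ >>= λ h → h g) ≡ leaf (fold merge κ (f d))
Sim-apply F D G with F _ _ D
... | h , e , H rewrite e = H _ _ G

-- The recursor runs at type `Comp σ`: the computation for `suc n` is the one for `n` with a
-- continuation that performs one more step. The two uses of `fold->>=` match the two binds that
-- involve `recTree` and `v n`.
recCPS-sim : ∀ {Γ} {θ : Env Γ} {σ u u′ v v′} → Sim σ u u′ → Sim (nat ⇒ σ ⇒ σ) v v′ → ∀ n →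
             ∃[ h ] ⟦ recCPS σ ⟧ (θ ▸ (u′ , v′ , n)) ≡ leaf h × SimComp σ (recTree (u , v , n)) h
recCPS-sim U V zero = _ , refl , λ κ g G → G _ _ U
recCPS-sim {θ = θ} {σ} {u} {u′} {v} {v′} U V (suc n) with recCPS-sim {θ = θ} U V n
... | h , e , H = _ , cong (_>>= _) e , λ κ g G →
  trans (H _ _ λ r r′ R →
          trans (Sim-apply {nat} {σ ⇒ σ} {v} {v′} {n} V refl λ f f′ F → Sim-apply {σ} {σ} {f} {f′} F R G)
                (cong leaf (fold->>= (v n))))
        (cong leaf (fold->>= (recTree (u , v , n))))

-- Fundamental lemma of `Sim`. Each `bind` is an induction hypothesis whose continuation is the rest
-- of the computation, followed by `fold->>=`.
compile-sim : ∀ {Γ Δ σ} (M : Tm Γ σ) {ρ : CRen Γ Δ} {k} {η : Env Γ} {θ : Env Δ} →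
              (∀ {τ} (x : Γ ∋ τ) → Sim τ (η x) (θ (ρ x))) →
              ∀ κ → SimCont σ κ (θ k) → θ ⊢ compile M ρ k ↦ fold merge κ (⟦ M ⟧ η)
compile-sim (var x) S κ G .equation = G _ _ (S x)
compile-sim (lam M) S κ G .equation = G _ _ λ d d′ D → _ , refl , λ κ′ g′ G′ →
  compile-sim M (λ { here → D ; (there x) → S x }) κ′ G′ .equation
compile-sim {σ = τ} (app {σ} M N) {η = η} S κ G .equation = trans
  (compile-sim N S _ (λ d d′ D → trans
    (compile-sim M S _ (λ f f′ F → Sim-apply {σ} {τ} {f} {f′} F D G) .equation)
    (cong leaf (fold->>= (⟦ M ⟧ η)))) .equation)
  (cong leaf (fold->>= (⟦ N ⟧ η)))
compile-sim (pair M N) {η = η} S κ G .equation = trans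
  (compile-sim M S _ (λ d d′ D → trans
    (compile-sim N S _ (λ e e′ E → G _ _ (D , E)) .equation)
    (cong leaf (fold->>= (⟦ N ⟧ η)))) .equation)
  (cong leaf (fold->>= (⟦ M ⟧ η)))
compile-sim π₁ S κ G .equation = G _ _ λ p p′ P → _ , refl , λ κ′ g′ G′ → G′ _ _ (proj₁ P)
compile-sim π₂ S κ G .equation = G _ _ λ p p′ P → _ , refl , λ κ′ g′ G′ → G′ _ _ (proj₂ P)
compile-sim (rec {σ}) {θ = θ} S κ G .equation = G _ _ λ where
  (u , v , n) (u′ , v′ , _) (U , V , refl) → recCPS-sim {θ = θ} {σ} {u} {u′} {v} {v′} U V n
compile-sim zer S κ G .equation = G _ _ refl
compile-sim suc' S κ G .equation = G _ _ λ n n′ e → _ , refl , λ κ′ g′ G′ → G′ _ _ (cong suc e)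
compile-sim (M ⊕ N) S κ G = mergeT↦ (compile-sim M S κ G) (compile-sim N S κ G)

-- A leaf is a unanimous poll: margin 1 out of total weight 1. The inner continuation first obtains
-- the function denoted by `M`, then applies it to the input.
majority : Tm [] (nat ⇒ nat) → Tm [] (nat ⇒ nat)
majority M = lam (winner
  (bind (compile M (λ ()) here)
    (app (app v₀ v₁) (lam (pair v₀ (pair one one))))))

poll : Tree ℕ → ⟦ Poll ⟧ₜ
poll = fold merge (λ m → m , 1 , 1)

majority-leaf : ∀ M n → (⟦ majority M ⟧ ∅ >>= λ f → f n) ≡
                        leaf (proj₁ (poll (⟦ M ⟧ ∅ >>= λ f → f n)))
majority-leaf M n = cong (_>>= λ r → leaf (proj₁ r)) (trans
  (compile-sim M {η = ∅} (λ ()) _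
    (λ f f′ F → Sim-apply {nat} {nat} {f} {f′} {n} F refl λ { _ _ refl → refl }) .equation)
  (cong leaf (fold->>= (⟦ M ⟧ ∅))))

-- The compiled program is free of ⊕

-- Proof by reflection: on the fixed terms of the translation this computes to `just`, and
-- `from-just` extracts the derivation.
plusFree? : ∀ {Γ σ} (M : Tm Γ σ) → Maybe (PlusFree M)
plusFree? (var x)    = just (var x)
plusFree? (lam M)    = map lam (plusFree? M)
plusFree? (app M N)  = zipWith app (plusFree? M) (plusFree? N)
plusFree? (pair M N) = zipWith pair (plusFree? M) (plusFree? N)
plusFree? π₁         = just π₁
plusFree? π₂         = just π₂
plusFree? rec        = just rec
plusFree? zer        = just zer
plusFree? suc'       = just suc'
plusFree? (M ⊕ N)    = nothing

bind-plusFree : ∀ {Γ σ} {C : Tm ((σ ⇒ Poll) ∷ Γ) Poll} {K : Tm (σ ∷ Γ) Poll} →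
                PlusFree C → PlusFree K → PlusFree (bind C K)
bind-plusFree C K = app (lam C) (lam K)

compile-plusFree : ∀ {Γ Δ σ} (M : Tm Γ σ) {ρ : CRen Γ Δ} {k} → PlusFree (compile M ρ k)
compile-plusFree (var x)    = app (var _) (var _)
compile-plusFree (lam M)    = app (var _) (lam (lam (compile-plusFree M)))
compile-plusFree (app M N)  =
  bind-plusFree (compile-plusFree N) (bind-plusFree (compile-plusFree M)
    (app (app (var _) (var _)) (var _)))
compile-plusFree (pair M N) =
  bind-plusFree (compile-plusFree M) (bind-plusFree (compile-plusFree N)
    (app (var _) (pair (var _) (var _))))
compile-plusFree π₁         = app (var _) (from-just (plusFree? (lam (lam (app v₀ (fst v₁))))))
compile-plusFree π₂         = app (var _) (from-just (plusFree? (lam (lam (app v₀ (snd v₁))))))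
compile-plusFree (rec {σ})  = app (var _) (lam (from-just (plusFree? (recCPS σ))))
compile-plusFree zer        = app (var _) zer
compile-plusFree suc'       = app (var _) (from-just (plusFree? (lam (lam (app v₀ (app suc' v₁))))))
compile-plusFree (M ⊕ N)    =
  app (app (lam (lam (from-just (plusFree? mergeBody)))) (compile-plusFree M)) (compile-plusFree N)

majority-plusFree : ∀ M → PlusFree (majority M)
majority-plusFree M = lam (app π₁ (bind-plusFree (compile-plusFree M)
  (from-just (plusFree? (app (app v₀ v₁) (lam (pair v₀ (pair one one))))))))

-- Weighted majority vote

votes : Tree ℕ → ℕ
votes t = proj₂ (proj₂ (poll t))

choose : ∀ {P A : Set} → Dec P → A → A → A
choose (yes _) x y = x
choose (no  _) x y = y

-- Numerator of the probability of `m` over the denominator `votes t`; the halving at a node is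
-- absorbed by the doubled denominator.
hits : ℕ → Tree ℕ → ℕ
hits m (leaf n)   = choose (n ≟ m) 1 0
hits m (node l r) = hits m l ℕ.* votes r ℕ.+ hits m r ℕ.* votes l

for against : ℕ → ℕ → ℕ → ℕ
for     m v a = choose (v ≟ m) a 0
against m v a = choose (v ≟ m) 0 a

-- The distance of two naturals, which `merge` uses both as the difference of margins and as the
-- equality test on candidates.
gap : ℕ → ℕ → ℕ
gap a b = (a ∸ b) ℕ.+ (b ∸ a)

gap-comm : ∀ a b → gap a b ≡ gap b a
gap-comm a b = ℕₚ.+-comm (a ∸ b) (b ∸ a)

≤⇒gap : ∀ {a b} → a ℕ.≤ b → gap a b ℕ.+ a ≡ b
≤⇒gap a≤b rewrite ℕₚ.m≤n⇒m∸n≡0 a≤b = ℕₚ.m∸n+n≡m a≤b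

≡-test : ∀ v w → (v ≡ w × ∀ x y → ifZeroℕ (gap v w) x y ≡ x) ⊎
                 (v ≢ w × ∀ x y → ifZeroℕ (gap v w) x y ≡ y)
≡-test v w with gap v w in eq
... | zero  = inj₁ (ℕₚ.≤-antisym (ℕₚ.m∸n≡0⇒m≤n (ℕₚ.m+n≡0⇒m≡0 (v ∸ w) eq))
                                 (ℕₚ.m∸n≡0⇒m≤n (ℕₚ.m+n≡0⇒n≡0 (v ∸ w) eq))
                   , λ _ _ → refl)
... | suc _ = inj₂ ((λ { refl → ℕₚ.0≢1+n (trans (sym (cong₂ ℕ._+_ (ℕₚ.n∸n≡0 v) (ℕₚ.n∸n≡0 v))) eq) })
                   , λ _ _ → refl)

≤-test : ∀ a b → (a ℕ.≤ b × ∀ x y → ifZeroℕ (a ∸ b) x y ≡ x) ⊎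
                 (b ℕ.≤ a × ∀ x y → ifZeroℕ (a ∸ b) x y ≡ y)
≤-test a b with a ∸ b in eq
... | zero  = inj₁ (ℕₚ.m∸n≡0⇒m≤n eq , λ _ _ → refl)
... | suc _ = inj₂ (ℕₚ.<⇒≤ (ℕₚ.m∸n≢0⇒n<m (λ z → ℕₚ.1+n≢0 (trans (sym eq) z))) , λ _ _ → refl)

agree : ∀ m v a b → against m v (a ℕ.+ b) ℕ.+ (for m v a ℕ.+ for m v b) ≡
                    for m v (a ℕ.+ b) ℕ.+ (against m v a ℕ.+ against m v b)
agree m v a b with v ≟ m
... | yes _ = sym (ℕₚ.+-identityʳ _)
... | no  _ = ℕₚ.+-identityʳ _

-- The cancellation of Boyer and Moore, with signed margins. If `m` is one of the two candidates the
-- balance is exact; if it is neither, -a - b ≤ -(b - a) leaves a slack of 2a.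
disagree : ∀ m {v w a b g} → v ≢ w → g ℕ.+ a ≡ b →
           against m w g ℕ.+ (for m v a ℕ.+ for m w b) ℕ.≤
           for m w g ℕ.+ (against m v a ℕ.+ against m w b)
disagree m {v} {w} {a} {b} {g} v≢w refl with v ≟ m | w ≟ m
... | yes refl | yes refl = contradiction refl v≢w
... | yes _    | no _     = ℕₚ.≤-reflexive (cong (g ℕ.+_) (ℕₚ.+-identityʳ a))
... | no _     | yes _    = ℕₚ.≤-reflexive (trans (ℕₚ.+-comm g a)
                              (trans (ℕₚ.+-comm a g) (cong (g ℕ.+_) (sym (ℕₚ.+-identityʳ a)))))
... | no _     | no _     = begin
  g ℕ.+ 0           ≡⟨ ℕₚ.+-identityʳ g ⟩
  g                 ≤⟨ ℕₚ.m≤m+n g a ⟩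
  g ℕ.+ a           ≤⟨ ℕₚ.m≤n+m (g ℕ.+ a) a ⟩
  a ℕ.+ (g ℕ.+ a)   ∎
  where open ℕₚ.≤-Reasoning

-- Agreeing candidates pool their margins exactly, whichever side the test picks; differing ones
-- fall under `disagree`, with the roles swapped when the first margin is the larger.
merge-balance : ∀ m v w a b →
  let u = ifZeroℕ (a ∸ b) w v
      g = ifZeroℕ (gap v w) (a ℕ.+ b) (gap a b)
  in against m u g ℕ.+ (for m v a ℕ.+ for m w b) ℕ.≤
     for m u g ℕ.+ (against m v a ℕ.+ against m w b)
merge-balance m v w a b with ≡-test v w | ≤-test a b
... | inj₁ (refl , e) | inj₁ (_ , e′) rewrite e (a ℕ.+ b) (gap a b) | e′ v v =
  ℕₚ.≤-reflexive (agree m v a b)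
... | inj₁ (refl , e) | inj₂ (_ , e′) rewrite e (a ℕ.+ b) (gap a b) | e′ v v =
  ℕₚ.≤-reflexive (agree m v a b)
... | inj₂ (v≢w , e) | inj₁ (a≤b , e′) rewrite e (a ℕ.+ b) (gap a b) | e′ w v =
  disagree m v≢w (≤⇒gap a≤b)
... | inj₂ (v≢w , e) | inj₂ (b≤a , e′) rewrite e (a ℕ.+ b) (gap a b) | e′ w v
  | gap-comm a b | ℕₚ.+-comm (for m v a) (for m w b) | ℕₚ.+-comm (against m v a) (against m w b) =
  disagree m (λ e → v≢w (sym e)) (≤⇒gap b≤a)

-- 2c − d ≤ ±a, where the margin a counts positively exactly when the candidate is m; the two
-- sides are arranged so that no subtraction occurs.
record Majorises (m c : ℕ) (r : ⟦ Poll ⟧ₜ) : Set where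
  constructor bounded
  field
    bound : let v , a , d = r in c ℕ.+ c ℕ.+ against m v a ℕ.≤ d ℕ.+ for m v a

open Majorises

for-* : ∀ m v a e → for m v (a ℕ.* e) ≡ for m v a ℕ.* e
for-* m v a e with v ≟ m
... | yes _ = refl
... | no  _ = refl

against-* : ∀ m v a e → against m v (a ℕ.* e) ≡ against m v a ℕ.* e
against-* m v a e with v ≟ m
... | yes _ = refl
... | no  _ = refl

scale : ∀ {m c v a d} e → Majorises m c (v , a , d) →
        Majorises m (c ℕ.* e) (v , a ℕ.* e , d ℕ.* e)
scale {m} {c} {v} {a} {d} e h .bound rewrite for-* m v a e | against-* m v a e = begin
  c ℕ.* e ℕ.+ c ℕ.* e ℕ.+ against m v a ℕ.* e
    ≡⟨ solve 3 (λ c x e → c :* e :+ c :* e :+ x :* e := (c :+ c :+ x) :* e) refl c (against m v a) e ⟩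
  (c ℕ.+ c ℕ.+ against m v a) ℕ.* e
    ≤⟨ ℕₚ.*-monoˡ-≤ e (h .bound) ⟩
  (d ℕ.+ for m v a) ℕ.* e
    ≡⟨ ℕₚ.*-distribʳ-+ e d (for m v a) ⟩
  d ℕ.* e ℕ.+ for m v a ℕ.* e ∎
  where
  open ℕₚ.≤-Reasoning
  open ℕ-Solver.+-*-Solver

merge-majorises : ∀ {m c c′} r s → Majorises m c r → Majorises m c′ s →
                  Majorises m (c ℕ.* proj₂ (proj₂ s) ℕ.+ c′ ℕ.* proj₂ (proj₂ r)) (merge r s)
merge-majorises {m} {c} {c′} r@(v , a , d) s@(w , b , e) h h′ .bound =
  ℕₚ.+-cancelʳ-≤ (f₁ ℕ.+ f₂ ℕ.+ (x₁ ℕ.+ x₂)) _ _ (begin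
    X ℕ.+ Y ℕ.+ (X ℕ.+ Y) ℕ.+ against m u g ℕ.+ (f₁ ℕ.+ f₂ ℕ.+ (x₁ ℕ.+ x₂))
      ≡⟨ solve 7 (λ X Y z f₁ f₂ x₁ x₂ →
           X :+ Y :+ (X :+ Y) :+ z :+ (f₁ :+ f₂ :+ (x₁ :+ x₂)) :=
           (X :+ X :+ x₁) :+ (Y :+ Y :+ x₂) :+ (z :+ (f₁ :+ f₂)))
           refl X Y (against m u g) f₁ f₂ x₁ x₂ ⟩
    (X ℕ.+ X ℕ.+ x₁) ℕ.+ (Y ℕ.+ Y ℕ.+ x₂) ℕ.+ (against m u g ℕ.+ (f₁ ℕ.+ f₂))
      ≤⟨ ℕₚ.+-mono-≤ (ℕₚ.+-mono-≤ (scale e h .bound) (scale d h′ .bound))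
                     (merge-balance m v w (a ℕ.* e) (b ℕ.* d)) ⟩
    (d ℕ.* e ℕ.+ f₁) ℕ.+ (e ℕ.* d ℕ.+ f₂) ℕ.+ (for m u g ℕ.+ (x₁ ℕ.+ x₂))
      ≡⟨ solve 7 (λ d e z f₁ f₂ x₁ x₂ →
           (d :* e :+ f₁) :+ (e :* d :+ f₂) :+ (z :+ (x₁ :+ x₂)) :=
           d :* e :+ d :* e :+ z :+ (f₁ :+ f₂ :+ (x₁ :+ x₂)))
           refl d e (for m u g) f₁ f₂ x₁ x₂ ⟩
    d ℕ.* e ℕ.+ d ℕ.* e ℕ.+ for m u g ℕ.+ (f₁ ℕ.+ f₂ ℕ.+ (x₁ ℕ.+ x₂)) ∎)
  where
  open ℕₚ.≤-Reasoning
  open ℕ-Solver.+-*-Solver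
  X  = c ℕ.* e
  Y  = c′ ℕ.* d
  u  = proj₁ (merge r s)
  g  = proj₁ (proj₂ (merge r s))
  f₁ = for m v (a ℕ.* e)
  f₂ = for m w (b ℕ.* d)
  x₁ = against m v (a ℕ.* e)
  x₂ = against m w (b ℕ.* d)

poll-majorises : ∀ m t → Majorises m (hits m t) (poll t)
poll-majorises m (leaf n) .bound with n ≟ m
... | yes _ = ℕₚ.≤-refl
... | no  _ = ℕₚ.≤-refl
poll-majorises m (node l r) =
  merge-majorises (poll l) (poll r) (poll-majorises m l) (poll-majorises m r)

-- If another candidate won, `for` vanishes and the bound says that twice the hits plus the margin
-- is at most the votes.
absolute-majority : ∀ m t → votes t ℕ.< hits m t ℕ.+ hits m t → proj₁ (poll t) ≡ m
absolute-majority m t lt with proj₁ (poll t) ≟ m | poll-majorises m t .bound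
... | yes e | _ = e
... | no  _ | h = contradiction (ℕₚ.<-≤-trans lt
  (ℕₚ.≤-trans (ℕₚ.m≤m+n _ _) (ℕₚ.≤-trans h (ℕₚ.≤-reflexive (ℕₚ.+-identityʳ _)))))
  (ℕₚ.<-irrefl refl)

-- Probabilities

probability : ℕ → Tree ℕ → ℚ
probability m (leaf n)   = choose (n ≟ m) 1ℚ 0ℚ
probability m (node l r) = ½ * probability m l + ½ * probability m r

numeral?-num : ∀ n → numeral? (num n) ≡ just n
numeral?-num zero = refl
numeral?-num (suc n) rewrite numeral?-num n = refl

massAt-++ : ∀ m D E → massAt m (D ++ E) ≡ massAt m D + massAt m E
massAt-++ m []            E = sym (ℚₚ.+-identityˡ _)
massAt-++ m ((p , M) ∷ D) E rewrite massAt-++ m D E with numeral? M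
... | nothing = sym (ℚₚ.+-assoc 0ℚ (massAt m D) (massAt m E))
... | just n with n ≟ m
...   | yes _ = sym (ℚₚ.+-assoc p (massAt m D) (massAt m E))
...   | no  _ = sym (ℚₚ.+-assoc 0ℚ (massAt m D) (massAt m E))

massAt-dist : ∀ m p t → massAt m (dist p t) ≡ p * probability m t
massAt-dist m p (leaf n) rewrite numeral?-num n with n ≟ m
... | yes _ = trans (ℚₚ.+-identityʳ p) (sym (ℚₚ.*-identityʳ p))
... | no  _ = sym (ℚₚ.*-zeroʳ p)
massAt-dist m p (node l r) = begin
  massAt m (dist (p * ½) l ++ dist (p * ½) r)
    ≡⟨ massAt-++ m (dist (p * ½) l) (dist (p * ½) r) ⟩
  massAt m (dist (p * ½) l) + massAt m (dist (p * ½) r)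
    ≡⟨ cong₂ _+_ (massAt-dist m (p * ½) l) (massAt-dist m (p * ½) r) ⟩
  p * ½ * probability m l + p * ½ * probability m r
    ≡⟨ cong₂ _+_ (ℚₚ.*-assoc p ½ _) (ℚₚ.*-assoc p ½ _) ⟩
  p * (½ * probability m l) + p * (½ * probability m r)
    ≡⟨ ℚₚ.*-distribˡ-+ p _ _ ⟨
  p * probability m (node l r) ∎
  where open ≡.≡-Reasoning

-- As an iterated sum of `1ℚ`, the embedding inherits its homomorphism laws from the general theory
-- of semirings.
ι : ℕ → ℚ
ι n = n · 1ℚ

ι-mono : ∀ {m n} → m ℕ.≤ n → ι m ≤ ι n
ι-mono {n = zero} z≤n    = ℚₚ.≤-refl
ι-mono {n = suc n} z≤n   = ℚₚ.≤-trans (ι-mono {n = n} z≤n)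
  (ℚₚ.≤-trans (ℚₚ.≤-reflexive (sym (ℚₚ.+-identityˡ _)))
              (ℚₚ.+-monoˡ-≤ (ι n) (from-yes (0ℚ ℚ.≤? 1ℚ))))
ι-mono (s≤s m≤n) = ℚₚ.+-monoʳ-≤ 1ℚ (ι-mono m≤n)

probability-poll : ∀ m t → probability m t * ι (votes t) ≡ ι (hits m t)
probability-poll m (leaf n) with n ≟ m
... | yes _ = refl
... | no  _ = refl
probability-poll m (node l r) = begin
  (½ * p + ½ * q) * ι (d ℕ.* e ℕ.+ d ℕ.* e)
    ≡⟨ cong ((½ * p + ½ * q) *_) (trans (×-homo-+ 1ℚ (d ℕ.* e) (d ℕ.* e))
         (cong₂ _+_ (×1-homo-* d e) (×1-homo-* d e))) ⟩
  (½ * p + ½ * q) * (ι d * ι e + ι d * ι e)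
    ≡⟨ solve 5 (λ h p q x y → (h :* p :+ h :* q) :* (x :* y :+ x :* y) :=
         (h :+ h) :* ((p :* x) :* y :+ (q :* y) :* x)) refl ½ p q (ι d) (ι e) ⟩
  1ℚ * (p * ι d * ι e + q * ι e * ι d)
    -- The solver treats `½` as an indeterminate; `½ + ½` becomes `1ℚ` by computation.
    ≡⟨ ℚₚ.*-identityˡ _ ⟩
  p * ι d * ι e + q * ι e * ι d
    ≡⟨ cong₂ (λ x y → x * ι e + y * ι d) (probability-poll m l) (probability-poll m r) ⟩
  ι (hits m l) * ι e + ι (hits m r) * ι d
    ≡⟨ cong₂ _+_ (×1-homo-* (hits m l) e) (×1-homo-* (hits m r) d) ⟨
  ι (hits m l ℕ.* e) + ι (hits m r ℕ.* d)
    ≡⟨ ×-homo-+ 1ℚ (hits m l ℕ.* e) (hits m r ℕ.* d) ⟨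
  ι (hits m (node l r)) ∎
  where
  open ≡.≡-Reasoning
  open ℚ-Solver.+-*-Solver
  p = probability m l
  q = probability m r
  d = votes l
  e = votes r

votes>0 : ∀ t → 1 ℕ.≤ votes t
votes>0 (leaf n)   = ℕₚ.≤-refl
votes>0 (node l r) = ℕₚ.≤-trans (ℕₚ.*-mono-≤ (votes>0 l) (votes>0 r)) (ℕₚ.m≤m+n _ _)

winner-probable : ∀ m t → ½ < probability m t → proj₁ (poll t) ≡ m
winner-probable m t ½<p = absolute-majority m t (ℕₚ.≰⇒> λ 2h≤d → ℚₚ.<-irrefl refl (begin-strict
  ι (votes t)                       ≡⟨ ℚₚ.*-identityˡ (ι (votes t)) ⟨
  (½ + ½) * ι (votes t)             <⟨ ℚₚ.*-monoˡ-<-pos (ι (votes t)) (ℚₚ.+-mono-< ½<p ½<p) ⟩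
  (p + p) * ι (votes t)             ≡⟨ ℚₚ.*-distribʳ-+ (ι (votes t)) p p ⟩
  p * ι (votes t) + p * ι (votes t) ≡⟨ cong₂ _+_ (probability-poll m t) (probability-poll m t) ⟩
  ι (hits m t) + ι (hits m t)       ≡⟨ ×-homo-+ 1ℚ (hits m t) (hits m t) ⟨
  ι (hits m t ℕ.+ hits m t)         ≤⟨ ι-mono 2h≤d ⟩
  ι (votes t)                       ∎))
  where
  open ℚₚ.≤-Reasoning
  p = probability m t
  instance
    ι-votes-positive : ℚ.Positive (ι (votes t))
    ι-votes-positive = ℚ.positive (ℚₚ.<-≤-trans (from-yes (0ℚ ℚ.<? ι 1)) (ι-mono (votes>0 t)))

-- Limits

LimGt-weaken : ∀ {a c d} → d ≤ c → LimGt a c → LimGt a d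
LimGt-weaken d≤c (δ , δ>0 , K , h) =
  δ , δ>0 , K , λ k K≤k → ℚₚ.≤-trans (ℚₚ.+-monoˡ-≤ δ d≤c) (h k K≤k)

LimGt⇒LimGe : ∀ {a} c → LimGt a c → LimGe a c
LimGt⇒LimGe {a} c (δ , δ>0 , K , h) ε ε>0 = K , λ k K≤k → begin-strict
  c - ε    <⟨ ℚₚ.+-monoʳ-< c (ℚₚ.neg-antimono-< ε>0) ⟩
  c + 0ℚ   <⟨ ℚₚ.+-monoʳ-< c δ>0 ⟩
  c + δ    ≤⟨ h k K≤k ⟩
  a k      ∎
  where open ℚₚ.≤-Reasoning

LimGe-⅔⇒LimGt-½ : ∀ {a} → LimGe a twoThirds → LimGt a ½
LimGe-⅔⇒LimGt-½ h with h (+ 1 / 12) (from-yes (0ℚ ℚ.<? + 1 / 12))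
-- 1/12 is half of ⅔ - ½, so ⅔ - 1/12 and ½ + 1/12 are the same rational 7/12.
... | K , h′ = + 1 / 12 , from-yes (0ℚ ℚ.<? + 1 / 12) , K , λ k K≤k → ℚₚ.<⇒≤ (h′ k K≤k)

LimGt-½⇒½< : ∀ {a b} → (∃[ K ] (∀ k → K ℕ.≤ k → a k ≡ b)) → LimGt a ½ → ½ < b
LimGt-½⇒½< {a} {b} (K , e) (δ , δ>0 , L , h) = begin-strict
  ½           <⟨ ℚₚ.+-monoʳ-< ½ δ>0 ⟩
  ½ + δ       ≤⟨ h (K ⊔ L) (ℕₚ.m≤n⊔m K L) ⟩
  a (K ⊔ L)   ≡⟨ e (K ⊔ L) (ℕₚ.m≤m⊔n K L) ⟩
  b           ∎
  where open ℚₚ.≤-Reasoning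

recip-nonNegative : ∀ n → 0ℚ ≤ recip n
recip-nonNegative zero    = ℚₚ.≤-refl
recip-nonNegative (suc n) = ℚₚ.nonNegative⁻¹ (+ 1 / suc n) {{ℚₚ.normalize-nonNeg 1 (suc n)}}

-- Termination makes the sequence eventually constant, so its limit is the exact probability in the
-- tree.
prob-tree : ∀ {M t} m → Eval (Val nat) M t →
            ∃[ K ] (∀ k → K ℕ.≤ k → prob m M k ≡ probability m t)
prob-tree {t = t} m E with evalStep-dist E
... | K , h = K , λ k K≤k → trans (cong (massAt m) (h k K≤k))
  (trans (massAt-dist m 1ℚ t) (ℚₚ.*-identityˡ _))

-- Definability in System T and the equivalence of the classes

leaf⇒DT : ∀ {f} M → PlusFree M → (∀ n → (⟦ M ⟧ ∅ >>= λ g → g n) ≡ leaf (f n)) → DT f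
leaf⇒DT M pf e = M , pf , λ n → reaches (≡.subst (Eval _ _) (e n) (Eval-app-num M n))
  where
  reaches : ∀ {M m} → Eval (Val nat) M (leaf m) → ∃[ k ] evalStep k M ≡ dirac (num m)
  reaches E with evalStep-dist E
  ... | K , h = K , h K ℕₚ.≤-refl

-- Supplies the function `h` of `BPf`. Since `num` lives in the empty context, numerals are rebuilt
-- in arbitrary contexts.
DT-const : ∀ m → DT (λ _ → m)
DT-const m = leaf⇒DT (lam (numeral m)) (lam (numeral-plusFree m)) (λ n → numeral-leaf m)
  where
  numeral : ∀ {Γ} → ℕ → Tm Γ nat
  numeral zero    = zer
  numeral (suc m) = app suc' (numeral m)

  numeral-plusFree : ∀ {Γ} m → PlusFree (numeral {Γ} m)
  numeral-plusFree zero    = zer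
  numeral-plusFree (suc m) = app suc' (numeral-plusFree m)

  numeral-leaf : ∀ {Γ} {η : Env Γ} m → ⟦ numeral m ⟧ η ≡ leaf m
  numeral-leaf zero = refl
  numeral-leaf {η = η} (suc m) rewrite numeral-leaf {η = η} m = refl

PrC⇒DT : ∀ {f} → PrC f → DT f
PrC⇒DT {f} (M , h) = leaf⇒DT (majority M) (majority-plusFree M) λ n →
  trans (majority-leaf M n) (cong leaf (winner-probable (f n) (⟦ M ⟧ ∅ >>= λ g → g n)
    (LimGt-½⇒½< (prob-tree (f n) (Eval-app-num M n)) (h n))))

massAt-num : ∀ m → massAt m (dirac (num m)) ≡ 1ℚ
massAt-num m rewrite numeral?-num m with m ≟ m
... | yes _  = refl
... | no m≢m = contradiction refl m≢m

evalStep-stable : ∀ {σ} {M V : Tm [] σ} k j → Value V → evalStep k M ≡ dirac V →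
             evalStep (j ℕ.+ k) M ≡ dirac V
evalStep-stable k zero    v e = e
evalStep-stable k (suc j) v e = trans (cong stepD (evalStep-stable k j v e)) (run-value 1 1ℚ v)

-- Once the value is reached its probability is 1. The slack 1/6 suits all thresholds used, the
-- largest being ½ + 1/3 = 5/6.
DT⇒LimGt : ∀ {f} ((M , _) : DT f) c → c + + 1 / 6 ≤ 1ℚ →
           ∀ n → LimGt (prob (f n) (app M (num n))) c
DT⇒LimGt {f} (M , _ , h) c c≤ n with h n
... | K , e = + 1 / 6 , from-yes (0ℚ ℚ.<? + 1 / 6) , K , λ k K≤k → begin
  c + + 1 / 6                         ≤⟨ c≤ ⟩
  1ℚ                                  ≡⟨ massAt-num (f n) ⟨
  massAt (f n) (dirac (num (f n)))
    ≡⟨ cong (massAt (f n)) (evalStep-stable K (k ∸ K) (value-num (f n)) e) ⟨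
  prob (f n) (app M (num n)) (k ∸ K ℕ.+ K)
    ≡⟨ cong (prob (f n) _) (ℕₚ.m∸n+n≡m K≤k) ⟩
  prob (f n) (app M (num n)) k        ∎
  where open ℚₚ.≤-Reasoning

mainTheorem8 : (f : ℕ → ℕ) →
    (PrC f ⇔ DT f) × (BP f ⇔ DT f) × (BPf f ⇔ DT f)
mainTheorem8 f =
    mk⇔ PrC⇒DT
        (λ d → proj₁ d , DT⇒LimGt d ½ (from-yes (½ + + 1 / 6 ℚ.≤? 1ℚ)))
  , mk⇔ (λ (M , h) → PrC⇒DT (M , λ n → LimGe-⅔⇒LimGt-½ (h n)))
        (λ d → proj₁ d , λ n →
            LimGt⇒LimGe twoThirds (DT⇒LimGt d twoThirds (from-yes (twoThirds + + 1 / 6 ℚ.≤? 1ℚ)) n))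
  , mk⇔ (λ (h , _ , _ , M , p) → PrC⇒DT (M , λ n → LimGt-weaken (½≤½+recip (h n)) (p n)))
        -- 3 is the least nonzero constant with ½ + 1/h below 1; at h = 2 the threshold is already
        -- 1.
        (λ d → (λ _ → 3) , DT-const 3 , (λ _ ()) , proj₁ d
             , DT⇒LimGt d (½ + recip 3) (from-yes (½ + recip 3 + + 1 / 6 ℚ.≤? 1ℚ)))
  where
  ½≤½+recip : ∀ n → ½ ≤ ½ + recip n
  ½≤½+recip n = ℚₚ.+-monoʳ-≤ ½ (recip-nonNegative n)
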